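{- Let $q$ be a prime power, let $n\ge k\ge 1$ be integers, let $\mathcal{C}$ be an $[n,k,d]_q$ code, and let $c\in\mathcal{C}$ be a maximal codeword. Then $\omega(c)\ge (q-1)(k-1)+1$. In particular, if $\mathcal{C}$ is minimal, then $d\ge (q-1)(k-1)+1$.
   Context: For $v\in\mathbb{F}_q^n$, the support is $\sigma(v)=\{i : v_i\ne 0\}\subseteq\{1,\dots,n\}$ and the weight is $\omega(v)=|\sigma(v)|$. An $[n,k]_q$ code is an $\mathbb{F}_q$-linear subspace $\mathcal{C}\subseteq\mathbb{F}_q^n$ of dimension $k\ge1$; it is an $[n,k,d]_q$ code if $d$ is its minimum distance, $d=\min\{\omega(c): c\in\mathcal{C},\ c\neq 0\}$. A nonzero codeword $c\in\mathcal{C}$ is minimal if every $c'\in\mathcal{C}$ with $\sigma(c')\subseteq\sigma(c)$ is a scalar multiple of $c$; it is maximal if every $c'\in\mathcal{C}$ with $\sigma(c')\supseteq\sigma(c)$ is a scalar multiple of $c$. The code $\mathcal{C}$ is minimal if all its nonzero codewords are minimal. -}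

module Defs where

open import Level using (Level; _⊔_) renaming (suc to lsuc)
open import Algebra.Apartness.Bundles using (HeytingField; HeytingCommutativeRing)
open import Algebra.Bundles using (CommutativeRing)
import Algebra.Properties.Monoid.Sum as MonoidSum
open import Data.Bool.Base using (not)
open import Data.Fin.Base using (Fin)
import Data.Fin.Properties as Fin
open import Data.Fin.Subset using (Subset; _⊆_; _⊇_; ∣_∣)
open import Data.Nat.Base using (ℕ; _≤_; _^_)
open import Data.Nat.Primality using (Prime)
open import Data.Product.Base using (∃-syntax; _×_)
import Data.Vec.Base as Vec
open import Data.Vec.Functional using (Vector; replicate; map; zipWith)
import Data.Vec.Functional.Relation.Binary.Equality.Setoid as VectorEquality
open import Function.Bundles using (Inverse)
open import Function.Properties.Inverse using (Inverse⇒Injection)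
open import Relation.Binary.Definitions using (Decidable)
open import Relation.Binary.PropositionalEquality.Core using (_≡_)
open import Relation.Binary.PropositionalEquality.Properties using (setoid)
open import Relation.Nullary.Decidable using (does; via-injection)
open import Relation.Nullary.Negation using (¬_)
open import Relation.Unary using (Pred; _∈_)

IsPrimePower : ℕ → Set
IsPrimePower q = ∃[ p ] ∃[ m ] (Prime p × 1 ≤ m × q ≡ p ^ m)

-- The library's fields carry a tight apartness.  In the presence of
-- `enumeration` equality is decidable and `x # y` is equivalent to `¬ x ≈ y`,
-- so these are the finite fields with q elements in the usual sense.
record FiniteField (a ℓ₁ ℓ₂ : Level) (q : ℕ) : Set (lsuc (a ⊔ ℓ₁ ⊔ ℓ₂)) where
  field
    heytingField : HeytingField a ℓ₁ ℓ₂

  commutativeRing : CommutativeRing a ℓ₁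
  commutativeRing =
    HeytingCommutativeRing.commutativeRing
      (HeytingField.heytingCommutativeRing heytingField)

  field
    enumeration : Inverse (CommutativeRing.setoid commutativeRing) (setoid (Fin q))

  open CommutativeRing commutativeRing using (_≈_)

  _≟_ : Decidable _≈_
  _≟_ = via-injection (Inverse⇒Injection enumeration) Fin._≟_

module Coding {a ℓ₁ ℓ₂ : Level} {q : ℕ} (F : FiniteField a ℓ₁ ℓ₂ q) where

  open FiniteField F using (commutativeRing; _≟_)
  open CommutativeRing commutativeRing
    using (Carrier; _≈_; _+_; _*_; 0#; +-monoid)
    renaming (setoid to F-setoid)
  open VectorEquality F-setoid public using (_≋_)
  open MonoidSum +-monoid using (sum)

  infixl 6 _+ᵛ_
  infixr 7 _*ᵛ_

  𝔽^ : ℕ → Set a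
  𝔽^ n = Vector Carrier n

  0ᵛ : ∀ {n} → 𝔽^ n
  0ᵛ {n} = replicate n 0#

  _+ᵛ_ : ∀ {n} → 𝔽^ n → 𝔽^ n → 𝔽^ n
  _+ᵛ_ = zipWith _+_

  _*ᵛ_ : ∀ {n} → Carrier → 𝔽^ n → 𝔽^ n
  s *ᵛ v = map (s *_) v

  combination : ∀ {n k} → Vector Carrier k → Vector (𝔽^ n) k → 𝔽^ n
  combination s b j = sum (λ i → (s i *ᵛ b i) j)

  σ : ∀ {n} → 𝔽^ n → Subset n
  σ v = Vec.tabulate (λ i → not (does (v i ≟ 0#)))

  ω : ∀ {n} → 𝔽^ n → ℕ
  ω v = ∣ σ v ∣

  record IsSubspace {n : ℕ} {ℓ : Level} (C : Pred (𝔽^ n) ℓ) : Set (a ⊔ ℓ₁ ⊔ ℓ) where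
    field
      resp     : ∀ {u v} → u ≋ v → u ∈ C → v ∈ C
      0-closed : 0ᵛ ∈ C
      +-closed : ∀ {u v} → u ∈ C → v ∈ C → u +ᵛ v ∈ C
      *-closed : ∀ s {v} → v ∈ C → s *ᵛ v ∈ C

  record IsBasis {n k : ℕ} {ℓ : Level} (C : Pred (𝔽^ n) ℓ) (b : Vector (𝔽^ n) k)
                 : Set (a ⊔ ℓ₁ ⊔ ℓ) where
    field
      members     : ∀ i → b i ∈ C
      independent : ∀ s → combination s b ≋ 0ᵛ → ∀ i → s i ≈ 0#
      spanning    : ∀ {v} → v ∈ C → ∃[ s ] v ≋ combination s b

  HasDimension : ∀ {n ℓ} → Pred (𝔽^ n) ℓ → ℕ → Set (a ⊔ ℓ₁ ⊔ ℓ)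
  HasDimension {n} C k = ∃[ b ] IsBasis {n} {k} C b

  record HasMinimumDistance {n : ℕ} {ℓ : Level} (C : Pred (𝔽^ n) ℓ) (d : ℕ)
                            : Set (a ⊔ ℓ₁ ⊔ ℓ) where
    field
      attained   : ∃[ c ] (c ∈ C × ¬ c ≋ 0ᵛ × ω c ≡ d)
      lowerBound : ∀ {c} → c ∈ C → ¬ c ≋ 0ᵛ → d ≤ ω c

  record IsCode[_,_,_] (n k d : ℕ) {ℓ : Level} (C : Pred (𝔽^ n) ℓ)
                       : Set (a ⊔ ℓ₁ ⊔ ℓ) where
    field
      isSubspace      : IsSubspace C
      dimension       : HasDimension C k
      minimumDistance : HasMinimumDistance C d

  record IsMinimalCodeword {n : ℕ} {ℓ : Level} (C : Pred (𝔽^ n) ℓ) (c : 𝔽^ n)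
                           : Set (a ⊔ ℓ₁ ⊔ ℓ) where
    field
      member  : c ∈ C
      nonzero : ¬ c ≋ 0ᵛ
      minimal : ∀ {c′} → c′ ∈ C → σ c′ ⊆ σ c → ∃[ s ] c′ ≋ s *ᵛ c

  record IsMaximalCodeword {n : ℕ} {ℓ : Level} (C : Pred (𝔽^ n) ℓ) (c : 𝔽^ n)
                           : Set (a ⊔ ℓ₁ ⊔ ℓ) where
    field
      member  : c ∈ C
      nonzero : ¬ c ≋ 0ᵛ
      maximal : ∀ {c′} → c′ ∈ C → σ c′ ⊇ σ c → ∃[ s ] c′ ≋ s *ᵛ c

  IsMinimalCode : ∀ {n ℓ} → Pred (𝔽^ n) ℓ → Set (a ⊔ ℓ₁ ⊔ ℓ)
  IsMinimalCode C = ∀ {c} → c ∈ C → ¬ c ≋ 0ᵛ → IsMinimalCodeword C c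

{-# OPTIONS --safe #-}
module Submission where

-- Fix i₀ in the support of the maximal codeword c and write v_s for the codeword
-- with coordinates s ∈ 𝔽^k.  If v_s vanishes at i₀ and differs from c on the rest of
-- the support of c, then v_s − c covers the support of c, so it is a multiple of
-- c, and v_s = 0.  Hence the polynomial
--   R(s) = ∏_{i ∈ σ(c), i ≠ i₀} (v_s(i) − c(i)) · ∏_{a ≠ 0} (v_s(i₀) − a)
-- is nonzero only at s = 0, and ∑_s R(s) = R(0) ≠ 0.  As ∑_x xʲ = 0 over 𝔽 for
-- j < q − 1, every polynomial of degree below k(q − 1) sums to zero over 𝔽^k, so
-- the degree (ω(c) − 1) + (q − 1) of R is at least k(q − 1).  In a minimal code
-- every nonzero codeword is maximal.

open import Defs
open import Level using (Level; _⊔_)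
open import Algebra.Apartness.Bundles using (HeytingField; HeytingCommutativeRing)
open import Algebra.Bundles using (CommutativeRing; CommutativeSemiring)
import Algebra.Apartness.Properties.HeytingCommutativeRing as HeytingProperties
import Algebra.Properties.CommutativeMonoid.Sum as CommutativeMonoidSum
import Algebra.Properties.CommutativeSemiring.Exp as CommutativeSemiringExp
import Algebra.Properties.Ring as RingProperties
import Algebra.Properties.Semiring.Sum as SemiringSum
import Algebra.Solver.Ring.NaturalCoefficients.Default as RingSolver
open import Data.Bool.Base using (true; false; not; if_then_else_)
open import Data.Fin.Base using (Fin; zero; suc; punchIn; punchOut; inject≤)
import Data.Fin.Permutation as Perm
import Data.Fin.Properties as Fin
import Data.Fin.Subset as Subset
open import Data.Nat.Base as ℕ using (ℕ; zero; suc; _+_; _*_; _∸_; _≤_; _≥_; _<_; s≤s)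
import Data.Nat.Properties as ℕ
open import Data.Product.Base using (∃-syntax; _×_; _,_; proj₁; proj₂)
open import Data.Vec.Base as Vec using (Vec; []; _∷_)
import Data.Vec.Properties as Vec
import Data.Vec.Functional as Vector
open Vector using (Vector)
open import Function.Base using (_∘_)
open import Function.Bundles using (Inverse)
open import Relation.Binary.PropositionalEquality as ≡ using (_≡_; _≢_)
import Relation.Binary.Reasoning.Setoid as SetoidReasoning
open import Relation.Nullary.Decidable using (yes; no; does; dec-true; dec-false; decidable-stable)
open import Relation.Nullary.Negation using (¬_; contradiction)
open import Relation.Unary using (Pred; _∈_)

-- Sums of naturals and removal of one index.

open CommutativeMonoidSum ℕ.+-0-commutativeMonoid
  using () renaming (sum to sumℕ; sum-remove to sumℕ-remove; sum-replicate-zero to sumℕ-zero)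

-- A form of `punchIn` with truncated subtraction, so that it applies to `Fin q` and `Fin n` where
-- the size is a variable and not visibly a successor.
others : ∀ {n} → Fin n → Fin (n ∸ 1) → Fin n
others {suc n} = punchIn

others-≢ : ∀ {n} (i : Fin n) j → others i j ≢ i
others-≢ {suc n} = Fin.punchInᵢ≢i

others-surjective : ∀ {n} {i j : Fin n} → j ≢ i → ∃[ l ] others i l ≡ j
others-surjective {suc n} j≢i = punchOut (j≢i ∘ ≡.sym) , Fin.punchIn-punchOut (j≢i ∘ ≡.sym)

sumℕ-others : ∀ {n} (i : Fin n) (t : Vector ℕ n) → sumℕ t ≡ t i + sumℕ (t ∘ others i)
sumℕ-others {suc n} i t = sumℕ-remove {i = i} t

sumℕ-replicate-1 : ∀ n → sumℕ {n} (λ _ → 1) ≡ n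
sumℕ-replicate-1 zero    = ≡.refl
sumℕ-replicate-1 (suc n) = ≡.cong suc (sumℕ-replicate-1 n)

sumℕ-increment : ∀ {m} (e : Vector ℕ m) i → sumℕ (Vector.updateAt e i suc) ≡ suc (sumℕ e)
sumℕ-increment {suc m} e zero    = ≡.refl
sumℕ-increment {suc m} e (suc i) =
  ≡.trans (≡.cong (e zero +_) (sumℕ-increment (e ∘ suc) i)) (ℕ.+-suc (e zero) _)

m<n∸1⇒1+m<n : ∀ {m n} → m < n ∸ 1 → suc m < n
m<n∸1⇒1+m<n {n = suc n} = s≤s

-- Monic polynomials and division by a linear factor.

module MonicPolynomials {a ℓ : Level} (R : CommutativeSemiring a ℓ) where

  open CommutativeSemiring R hiding (zero)
    renaming (_+_ to infixl 6 _⊕_; _*_ to infixl 7 _⊛_)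
  open CommutativeSemiringExp R
  open RingSolver R using (solve; _:+_; _:*_; _:=_; con)
  open SetoidReasoning setoid

  -- Monic polynomials, given by their lower coefficients in Horner order.
  ⟦_⟧ : ∀ {n} → Vec Carrier n → Carrier → Carrier
  ⟦ []     ⟧ x = 1#
  ⟦ c ∷ cs ⟧ x = c ⊕ x ⊛ ⟦ cs ⟧ x

  -- The identity p(x) − p(r) = (x − r) p′(x), with both sides moved so that no
  -- subtraction occurs.
  divide : ∀ {n} (p : Vec Carrier (suc n)) r →
           ∃[ p′ ] (∀ x → ⟦ p ⟧ x ⊕ r ⊛ ⟦_⟧ {n} p′ x ≈ ⟦ p ⟧ r ⊕ x ⊛ ⟦ p′ ⟧ x)
  divide (c ∷ []) r = [] , λ x →
    solve 3 (λ c r x → (c :+ x :* con 1) :+ r :* con 1 := (c :+ r :* con 1) :+ x :* con 1)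
      refl c r x
  divide (c ∷ p@(_ ∷ _)) r with p′ , eq ← divide p r = ⟦ p ⟧ r ∷ p′ , λ x → begin
    (c ⊕ x ⊛ ⟦ p ⟧ x) ⊕ r ⊛ (⟦ p ⟧ r ⊕ x ⊛ ⟦ p′ ⟧ x)
      ≈⟨ solve 6 (λ c r x px pr p′x → (c :+ x :* px) :+ r :* (pr :+ x :* p′x)
                                   := (c :+ r :* pr) :+ x :* (px :+ r :* p′x))
           refl c r x (⟦ p ⟧ x) (⟦ p ⟧ r) (⟦ p′ ⟧ x) ⟩
    (c ⊕ r ⊛ ⟦ p ⟧ r) ⊕ x ⊛ (⟦ p ⟧ x ⊕ r ⊛ ⟦ p′ ⟧ x)
      ≈⟨ +-congˡ (*-congˡ (eq x)) ⟩
    (c ⊕ r ⊛ ⟦ p ⟧ r) ⊕ x ⊛ (⟦ p ⟧ r ⊕ x ⊛ ⟦ p′ ⟧ x) ∎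

  ⟦X^_⟧ : ∀ n x → ⟦ Vec.replicate n 0# ⟧ x ≈ x ^ n
  ⟦X^ zero  ⟧ x = refl
  ⟦X^ suc n ⟧ x = trans (+-identityˡ _) (*-congˡ (⟦X^ n ⟧ x))

module Field {a ℓ₁ ℓ₂ : Level} {q : ℕ} (F : FiniteField a ℓ₁ ℓ₂ q) where

  open FiniteField F using (heytingField; commutativeRing; enumeration; _≟_) public
  open CommutativeRing commutativeRing hiding (zero)
    renaming (_+_ to infixl 6 _⊕_; _*_ to infixl 7 _⊛_) public
  open Coding F public
  open SemiringSum semiring public
  open CommutativeMonoidSum *-commutativeMonoid public
    using () renaming (sum to product; sum-cong-≋ to product-cong)
  open CommutativeSemiringExp commutativeSemiring public
  open RingProperties ring public
  open MonicPolynomials commutativeSemiring public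
  open Inverse enumeration using (to; from; to-cong; from-cong; strictlyInverseˡ; strictlyInverseʳ) public
  open SetoidReasoning setoid public

  -- Field arithmetic and the bound on the number of roots.

  1≉0 : ¬ 1# ≈ 0#
  1≉0 1≈0 = proj₂ (HeytingField.tight heytingField 1# 0#) 1≈0
    (HeytingProperties.1#0 (HeytingField.heytingCommutativeRing heytingField))

  -- Tightness yields only ¬ ¬ x # 0#; the inverse itself is found by searching
  -- the enumeration.
  inverse : ∀ {x} → ¬ x ≈ 0# → ∃[ y ] y ⊛ x ≈ 1#
  inverse {x} x≉0 with Fin.any? (λ i → (from i ⊛ x) ≟ 1#)
  ... | yes (i , eq) = from i , eq
  ... | no  none     = contradiction (proj₁ (tight x 0#) ¬x#0) x≉0
    where
    open HeytingField heytingField using (tight; #⇒invertible)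
    ¬x#0 : ¬ HeytingField._#_ heytingField x 0#
    ¬x#0 x#0 with y , y*[x-0]≈1 , _ ← #⇒invertible x#0 = none (to y , (begin
      from (to y) ⊛ x   ≈⟨ *-cong (strictlyInverseʳ y) (sym (trans (+-congˡ -0#≈0#) (+-identityʳ x))) ⟩
      y ⊛ (x - 0#)      ≈⟨ y*[x-0]≈1 ⟩
      1#                ∎))

  *-cancelˡ-≉0 : ∀ {x y z} → ¬ x ≈ 0# → x ⊛ y ≈ x ⊛ z → y ≈ z
  *-cancelˡ-≉0 {x} {y} {z} x≉0 xy≈xz with x⁻¹ , x⁻¹x≈1 ← inverse x≉0 = begin
    y               ≈⟨ *-identityˡ y ⟨
    1# ⊛ y          ≈⟨ *-congʳ x⁻¹x≈1 ⟨
    x⁻¹ ⊛ x ⊛ y     ≈⟨ *-assoc x⁻¹ x y ⟩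
    x⁻¹ ⊛ (x ⊛ y)   ≈⟨ *-congˡ xy≈xz ⟩
    x⁻¹ ⊛ (x ⊛ z)   ≈⟨ *-assoc x⁻¹ x z ⟨
    x⁻¹ ⊛ x ⊛ z     ≈⟨ *-congʳ x⁻¹x≈1 ⟩
    1# ⊛ z          ≈⟨ *-identityˡ z ⟩
    z               ∎

  *-≉0 : ∀ {x y} → ¬ x ≈ 0# → ¬ y ≈ 0# → ¬ x ⊛ y ≈ 0#
  *-≉0 {x} x≉0 y≉0 xy≈0 = y≉0 (*-cancelˡ-≉0 x≉0 (trans xy≈0 (sym (zeroʳ x))))

  product-≉0 : ∀ {n} (t : Vector Carrier n) → (∀ i → ¬ t i ≈ 0#) → ¬ product t ≈ 0#
  product-≉0 {zero}  t t≉0 = 1≉0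
  product-≉0 {suc n} t t≉0 = *-≉0 (t≉0 zero) (product-≉0 (t ∘ suc) (t≉0 ∘ suc))

  product-≈0 : ∀ {n} (t : Vector Carrier n) i → t i ≈ 0# → product t ≈ 0#
  product-≈0 {suc n} t zero    ti≈0 = trans (*-congʳ ti≈0) (zeroˡ _)
  product-≈0 {suc n} t (suc i) ti≈0 = trans (*-congˡ (product-≈0 (t ∘ suc) i ti≈0)) (zeroʳ _)

  sum-≈0 : ∀ {n} (t : Vector Carrier n) → (∀ i → t i ≈ 0#) → sum t ≈ 0#
  sum-≈0 {n} t t≈0 = trans (sum-cong-≋ t≈0) (sum-replicate-zero n)

  sum-single : ∀ {n} (i : Fin n) (t : Vector Carrier n) → (∀ j → j ≢ i → t j ≈ 0#) → sum t ≈ t i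
  sum-single {suc n} i t t≈0 = begin
    sum t                         ≈⟨ sum-remove {i = i} t ⟩
    t i ⊕ sum (t ∘ punchIn i)     ≈⟨ +-congˡ (sum-≈0 _ (λ j → t≈0 _ (others-≢ i j))) ⟩
    t i ⊕ 0#                      ≈⟨ +-identityʳ _ ⟩
    t i                           ∎

  -- Induction on the degree: dividing by X - `r zero` leaves a monic quotient of degree one less.
  -- Each other `r i` differs from `r zero`, so it must be a root of that quotient.
  too-many-roots : ∀ {n} (p : Vec Carrier n) (r : Vector Carrier (suc n)) →
                   (∀ {i j} → r i ≈ r j → i ≡ j) → ¬ (∀ i → ⟦ p ⟧ (r i) ≈ 0#)
  too-many-roots []          r r-inj roots = 1≉0 (roots zero)
  too-many-roots p@(_ ∷ _)   r r-inj roots with p′ , eq ← divide p (r zero) =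
    too-many-roots p′ (r ∘ suc) (Fin.suc-injective ∘ r-inj) λ i →
    decidable-stable (⟦ p′ ⟧ (r (suc i)) ≟ 0#) λ p′x≉0 →
    Fin.0≢1+n (r-inj (*-cancelˡ-≉0 p′x≉0 (begin
      ⟦ p′ ⟧ (r (suc i)) ⊛ r zero                        ≈⟨ *-comm _ _ ⟩
      r zero ⊛ ⟦ p′ ⟧ (r (suc i))                        ≈⟨ +-identityˡ _ ⟨
      0# ⊕ r zero ⊛ ⟦ p′ ⟧ (r (suc i))                   ≈⟨ +-congʳ (roots (suc i)) ⟨
      ⟦ p ⟧ (r (suc i)) ⊕ r zero ⊛ ⟦ p′ ⟧ (r (suc i))    ≈⟨ eq (r (suc i)) ⟩
      ⟦ p ⟧ (r zero) ⊕ r (suc i) ⊛ ⟦ p′ ⟧ (r (suc i))    ≈⟨ +-congʳ (roots zero) ⟩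
      0# ⊕ r (suc i) ⊛ ⟦ p′ ⟧ (r (suc i))                ≈⟨ +-identityˡ _ ⟩
      r (suc i) ⊛ ⟦ p′ ⟧ (r (suc i))                     ≈⟨ *-comm _ _ ⟩
      ⟦ p′ ⟧ (r (suc i)) ⊛ r (suc i)                     ∎)))

  from-injective : ∀ {i j} → from i ≈ from j → i ≡ j
  from-injective {i} {j} eq =
    ≡.trans (≡.sym (strictlyInverseˡ i)) (≡.trans (to-cong eq) (strictlyInverseˡ j))

  -- Otherwise all q elements would be roots of a monic polynomial of degree j + 2 < q. The equation
  -- is not divided by x, so that 0 satisfies it: a witness of its failure is nonzero.
  ∃-power-≉ : ∀ j → suc (suc j) < q → ∃[ x ] ¬ x ⊛ x ^ suc j ≈ x
  ∃-power-≉ j 2+j<q =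
    let i , x^≉x = Fin.¬∀⟶∃¬ q _ (λ i → (from i ⊛ from i ^ suc j) ≟ from i) not-all
    in from i , x^≉x
    where
    poly : Vec Carrier (suc (suc j))
    -- The polynomial X^(j+2) - X; its leading coefficient is implicit.
    poly = 0# ∷ - 1# ∷ Vec.replicate j 0#
    not-all : ¬ (∀ i → from i ⊛ from i ^ suc j ≈ from i)
    not-all all = too-many-roots poly (λ i → from (inject≤ i 2+j<q))
      (Fin.inject≤-injective 2+j<q 2+j<q _ _ ∘ from-injective) λ i →
      let x = from (inject≤ i 2+j<q) in begin
      0# ⊕ x ⊛ (- 1# ⊕ x ⊛ ⟦ Vec.replicate j 0# ⟧ x)   ≈⟨ +-identityˡ _ ⟩
      x ⊛ (- 1# ⊕ x ⊛ ⟦ Vec.replicate j 0# ⟧ x)        ≈⟨ *-congˡ (+-congˡ (*-congˡ (⟦X^ j ⟧ x))) ⟩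
      x ⊛ (- 1# ⊕ x ^ suc j)                           ≈⟨ distribˡ x _ _ ⟩
      x ⊛ - 1# ⊕ x ⊛ x ^ suc j                         ≈⟨ +-cong (trans (*-comm _ _) (-1*x≈-x x)) (all _) ⟩
      - x ⊕ x                                          ≈⟨ -‿inverseˡ x ⟩
      0#                                               ∎

  -- Power sums over the field.

  ∑F : (Carrier → Carrier) → Carrier
  ∑F g = sum (g ∘ from)

  -- The bijection becomes a permutation of `Fin q` only after conjugation by the enumeration, hence
  -- the congruence hypotheses.
  ∑F-bijection : (g f f⁻¹ : Carrier → Carrier) →
    (∀ {x y} → x ≈ y → g x ≈ g y) →
    (∀ {x y} → x ≈ y → f x ≈ f y) → (∀ {x y} → x ≈ y → f⁻¹ x ≈ f⁻¹ y) →
    (∀ x → f (f⁻¹ x) ≈ x) → (∀ x → f⁻¹ (f x) ≈ x) →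
    ∑F g ≈ ∑F (g ∘ f)
  ∑F-bijection g f f⁻¹ g-cong f-cong f⁻¹-cong ff⁻¹ f⁻¹f =
    trans (sum-permute (g ∘ from) (Perm.permutation
            (λ i → to (f (from i))) (λ i → to (f⁻¹ (from i)))
            (λ i → roundtrip f f⁻¹ f-cong ff⁻¹ i)
            (λ i → roundtrip f⁻¹ f f⁻¹-cong f⁻¹f i)))
          (sum-cong-≋ {q} (λ i → g-cong (strictlyInverseʳ _)))
    where
    roundtrip : (h h′ : Carrier → Carrier) → (∀ {x y} → x ≈ y → h x ≈ h y) →
                (∀ x → h (h′ x) ≈ x) → ∀ i → to (h (from (to (h′ (from i))))) ≡ i
    roundtrip h h′ h-cong hh′ i = ≡.trans
      (to-cong (trans (h-cong (strictlyInverseʳ _)) (hh′ (from i)))) (strictlyInverseˡ i)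

  -- Translation by 1 permutes the field, so adding ∑ 1 to ∑ x does not change it.
  ∑F-1≈0 : ∑F (λ _ → 1#) ≈ 0#
  ∑F-1≈0 = +-identityʳ-unique (∑F (λ x → x)) _ (begin
    ∑F (λ x → x) ⊕ ∑F (λ _ → 1#)   ≈⟨ ∑-distrib-+ {q} from (λ _ → 1#) ⟨
    ∑F (_⊕ 1#)                     ≈⟨ ∑F-bijection (λ x → x) (_⊕ 1#) (_- 1#) (λ eq → eq) +-congʳ +-congʳ
                                        (λ x → //-rightDividesˡ 1# x) (λ x → //-rightDividesʳ 1# x) ⟨
    ∑F (λ x → x)                   ∎)

  -- Multiplication by a nonzero x permutes the field.
  power-sum-scaling : ∀ {x} → ¬ x ≈ 0# → ∀ j → x ^ j ⊛ ∑F (_^ j) ≈ ∑F (_^ j)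
  power-sum-scaling {x} x≉0 j = begin
    x ^ j ⊛ ∑F (_^ j)                ≈⟨ *-distribˡ-sum {q} (x ^ j) (λ i → from i ^ j) ⟩
    ∑F (λ y → x ^ j ⊛ y ^ j)         ≈⟨ sum-cong-≋ {q} (λ i → ^-distrib-* x (from i) j) ⟨
    ∑F (λ y → (x ⊛ y) ^ j)           ≈⟨ ∑F-bijection (_^ j) (x ⊛_) (x⁻¹ ⊛_)
                                          (^-congˡ j) *-congˡ *-congˡ
                                          (cancel (trans (*-comm x x⁻¹) x⁻¹x≈1)) (cancel x⁻¹x≈1) ⟨
    ∑F (_^ j)                        ∎
    where
    x⁻¹ = proj₁ (inverse x≉0)
    x⁻¹x≈1 = proj₂ (inverse x≉0)
    cancel : ∀ {u v} → u ⊛ v ≈ 1# → ∀ y → u ⊛ (v ⊛ y) ≈ y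
    cancel {u} {v} uv≈1 y = trans (sym (*-assoc u v y)) (trans (*-congʳ uv≈1) (*-identityˡ y))

  fixed⇒≈0 : ∀ {x y} → x ⊛ y ≈ y → ¬ x ≈ 1# → y ≈ 0#
  fixed⇒≈0 {x} {y} xy≈y x≉1 = decidable-stable (y ≟ 0#) λ y≉0 →
    x≉1 (*-cancelˡ-≉0 y≉0 (trans (*-comm y x) (trans xy≈y (sym (*-identityʳ y)))))

  -- For j > 0 some nonzero x has xʲ ≠ 1, while scaling by xʲ fixes the sum; this forces the sum to
  -- be 0.
  power-sum : ∀ j → j < q ∸ 1 → ∑F (_^ j) ≈ 0#
  power-sum zero    _     = ∑F-1≈0
  power-sum (suc j) j<q-1 =
    let x , x^≉x = ∃-power-≉ j (m<n∸1⇒1+m<n j<q-1)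
        x≉0 = λ x≈0 → x^≉x (trans (trans (*-congʳ x≈0) (zeroˡ (x ^ suc j))) (sym x≈0))
    in fixed⇒≈0 {x ^ suc j} (power-sum-scaling {x} x≉0 (suc j))
         λ x^≈1 → x^≉x (trans (*-congˡ x^≈1) (*-identityʳ x))

  -- Sums over the space of vectors.

  ∑F-cong : ∀ {g h} → (∀ x → g x ≈ h x) → ∑F g ≈ ∑F h
  ∑F-cong g≈h = sum-cong-≋ {q} (g≈h ∘ from)

  ∑F-≈0 : ∀ {g} → (∀ x → g x ≈ 0#) → ∑F g ≈ 0#
  ∑F-≈0 g≈0 = sum-≈0 {q} _ (g≈0 ∘ from)

  ∑^ : ∀ m → (𝔽^ m → Carrier) → Carrier
  ∑^ zero    f = f Vector.[]
  ∑^ (suc m) f = ∑F (λ a → ∑^ m (λ x → f (a Vector.∷ x)))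

  ∑^-cong : ∀ m {f g : 𝔽^ m → Carrier} → (∀ x → f x ≈ g x) → ∑^ m f ≈ ∑^ m g
  ∑^-cong zero    f≈g = f≈g _
  ∑^-cong (suc m) f≈g = ∑F-cong λ a → ∑^-cong m λ x → f≈g (a Vector.∷ x)

  ∑^-+ : ∀ m (f g : 𝔽^ m → Carrier) → ∑^ m (λ x → f x ⊕ g x) ≈ ∑^ m f ⊕ ∑^ m g
  ∑^-+ zero    f g = refl
  ∑^-+ (suc m) f g = trans
    (∑F-cong λ a → ∑^-+ m (λ x → f (a Vector.∷ x)) (λ x → g (a Vector.∷ x)))
    (∑-distrib-+ {q} _ _)

  ∑^-* : ∀ m c (f : 𝔽^ m → Carrier) → ∑^ m (λ x → c ⊛ f x) ≈ c ⊛ ∑^ m f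
  ∑^-* zero    c f = refl
  ∑^-* (suc m) c f = trans
    (∑F-cong λ a → ∑^-* m c (λ x → f (a Vector.∷ x)))
    (sym (*-distribˡ-sum {q} c _))

  ∑^-≈0 : ∀ m {f : 𝔽^ m → Carrier} → (∀ x → f x ≈ 0#) → ∑^ m f ≈ 0#
  ∑^-≈0 zero    f≈0 = f≈0 _
  ∑^-≈0 (suc m) f≈0 = ∑F-≈0 λ a → ∑^-≈0 m λ x → f≈0 (a Vector.∷ x)

  ∑F-supported-at-0 : ∀ {g c} → (∀ {x} → x ≈ 0# → g x ≈ c) → (∀ {x} → ¬ x ≈ 0# → g x ≈ 0#) →
                      ∑F g ≈ c
  ∑F-supported-at-0 {g} at-0 off-0 = trans
    (sum-single (to 0#) (g ∘ from) λ j j≢0 → off-0 λ xj≈0 →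
      j≢0 (≡.trans (≡.sym (strictlyInverseˡ j)) (to-cong xj≈0)))
    (at-0 (strictlyInverseʳ 0#))

  -- The value is prescribed at every x ≋ `0ᵛ` because `f` is not assumed to respect ≋, and the sum
  -- meets zero only through its enumerated representative.
  ∑^-supported-at-0 : ∀ m {f : 𝔽^ m → Carrier} {c} →
    (∀ x → x ≋ 0ᵛ → f x ≈ c) → (∀ x → ¬ x ≋ 0ᵛ → f x ≈ 0#) → ∑^ m f ≈ c
  ∑^-supported-at-0 zero    at-0 off-0 = at-0 _ λ ()
  ∑^-supported-at-0 (suc m) at-0 off-0 = ∑F-supported-at-0
    (λ {a} a≈0 → ∑^-supported-at-0 m
      (λ x x≈0 → at-0 (a Vector.∷ x) λ { zero → a≈0 ; (suc i) → x≈0 i })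
      (λ x x≉0 → off-0 (a Vector.∷ x) λ ax≈0 → x≉0 (ax≈0 ∘ suc)))
    (λ {a} a≉0 → ∑^-≈0 m λ x → off-0 (a Vector.∷ x) λ ax≈0 → a≉0 (ax≈0 zero))

  -- Monomials and the vanishing of their sums.

  monomial : ∀ {m} → Vector ℕ m → 𝔽^ m → Carrier
  monomial e x = product (λ i → x i ^ e i)

  monomial-increment : ∀ {m} (e : Vector ℕ m) i x →
    monomial (Vector.updateAt e i suc) x ≈ x i ⊛ monomial e x
  monomial-increment {suc m} e zero    x = *-assoc (x zero) (x zero ^ e zero) _
  monomial-increment {suc m} e (suc i) x = begin
    x₀ ⊛ monomial (Vector.updateAt (e ∘ suc) i suc) (x ∘ suc)
      ≈⟨ *-congˡ (monomial-increment (e ∘ suc) i (x ∘ suc)) ⟩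
    x₀ ⊛ (x (suc i) ⊛ rest)   ≈⟨ *-assoc x₀ (x (suc i)) rest ⟨
    x₀ ⊛ x (suc i) ⊛ rest     ≈⟨ *-congʳ (*-comm x₀ (x (suc i))) ⟩
    x (suc i) ⊛ x₀ ⊛ rest     ≈⟨ *-assoc (x (suc i)) x₀ rest ⟩
    x (suc i) ⊛ (x₀ ⊛ rest)   ∎
    where
    x₀   = x zero ^ e zero
    rest = monomial (e ∘ suc) (x ∘ suc)

  -- By pigeonhole some exponent is below q - 1, and the power sum in that coordinate is a vanishing
  -- factor. If the first exponent is not such, dropping it lowers the total by at least q - 1, so
  -- the bound passes to the remaining coordinates.
  ∑^-monomial : ∀ m (e : Vector ℕ m) → sumℕ e < m * (q ∸ 1) → ∑^ m (monomial e) ≈ 0#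
  ∑^-monomial (suc m) e ∣e∣<D with e zero ℕ.<? q ∸ 1
  ... | yes e₀<q-1 = begin
    ∑F (λ a → ∑^ m (λ x → a ^ e zero ⊛ rest x))   ≈⟨ ∑F-cong (λ a → ∑^-* m (a ^ e zero) rest) ⟩
    ∑F (λ a → a ^ e zero ⊛ ∑^ m rest)             ≈⟨ *-distribʳ-sum {q} (∑^ m rest) (λ i → from i ^ e zero) ⟨
    ∑F (_^ e zero) ⊛ ∑^ m rest                    ≈⟨ *-congʳ (power-sum (e zero) e₀<q-1) ⟩
    0# ⊛ ∑^ m rest                                ≈⟨ zeroˡ _ ⟩
    0#                                            ∎
    where rest = monomial (e ∘ suc)
  ... | no  e₀≮q-1 = ∑F-≈0 λ a → begin
    ∑^ m (λ x → a ^ e zero ⊛ rest x)   ≈⟨ ∑^-* m (a ^ e zero) rest ⟩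
    a ^ e zero ⊛ ∑^ m rest             ≈⟨ *-congˡ (∑^-monomial m (e ∘ suc) ∣e′∣<D) ⟩
    a ^ e zero ⊛ 0#                    ≈⟨ zeroʳ _ ⟩
    0#                                 ∎
    where
    rest = monomial (e ∘ suc)
    ∣e′∣<D : sumℕ (e ∘ suc) < m * (q ∸ 1)
    ∣e′∣<D = ℕ.+-cancelˡ-< (q ∸ 1) _ _
      (ℕ.≤-<-trans (ℕ.+-monoˡ-≤ (sumℕ (e ∘ suc)) (ℕ.≮⇒≥ e₀≮q-1)) ∣e∣<D)

  -- Degree bounds tested by sums.

  -- "Degree at most d", as far as sums over 𝔽^ m can see; this replaces the
  -- expansion of a polynomial function into monomials.
  SumDegree : ∀ {m} → ℕ → (𝔽^ m → Carrier) → Set ℓ₁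
  SumDegree {m} d f = ∀ e → d + sumℕ e < m * (q ∸ 1) → ∑^ m (λ x → f x ⊛ monomial e x) ≈ 0#

  -- Degree is measured by the effect of multiplication by `g` on `SumDegree`. In this form products
  -- are handled by composition, which `SumDegree` alone would not give.
  HasDegree : ∀ {m} → ℕ → (𝔽^ m → Carrier) → Set (a ⊔ ℓ₁)
  HasDegree {m} d g = ∀ {e} {f : 𝔽^ m → Carrier} → SumDegree e f → SumDegree (d + e) (λ x → g x ⊛ f x)

  sumDegree-resp : ∀ {m d} {f g : 𝔽^ m → Carrier} → (∀ x → f x ≈ g x) → SumDegree d f → SumDegree d g
  sumDegree-resp {m} f≈g deg-f e lt =
    trans (∑^-cong m λ x → *-congʳ (sym (f≈g x))) (deg-f e lt)

  sumDegree-1 : ∀ {m} → SumDegree {m} 0 (λ _ → 1#)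
  sumDegree-1 {m} e lt = trans (∑^-cong m λ x → *-identityˡ (monomial e x)) (∑^-monomial m e lt)

  hasDegree-+ : ∀ {m d} {g h : 𝔽^ m → Carrier} →
                HasDegree d g → HasDegree d h → HasDegree d (λ x → g x ⊕ h x)
  hasDegree-+ {m} {d} {g} {h} deg-g deg-h {_} {f} deg-f e lt = begin
    ∑^ m (λ x → (g x ⊕ h x) ⊛ f x ⊛ monomial e x)
      ≈⟨ ∑^-cong m (λ x → trans (*-congʳ (distribʳ (f x) (g x) (h x))) (distribʳ (monomial e x) (g x ⊛ f x) (h x ⊛ f x))) ⟩
    ∑^ m (λ x → g x ⊛ f x ⊛ monomial e x ⊕ h x ⊛ f x ⊛ monomial e x)
      ≈⟨ ∑^-+ m (λ x → g x ⊛ f x ⊛ monomial e x) (λ x → h x ⊛ f x ⊛ monomial e x) ⟩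
    ∑^ m (λ x → g x ⊛ f x ⊛ monomial e x) ⊕ ∑^ m (λ x → h x ⊛ f x ⊛ monomial e x)
      ≈⟨ +-cong (deg-g deg-f e lt) (deg-h deg-f e lt) ⟩
    0# ⊕ 0#
      ≈⟨ +-identityˡ 0# ⟩
    0# ∎

  hasDegree-* : ∀ {m d e} {g h : 𝔽^ m → Carrier} →
                HasDegree d g → HasDegree e h → HasDegree (d + e) (λ x → g x ⊛ h x)
  hasDegree-* {d = d} {e} {g} {h} deg-g deg-h {d′} {f} deg-f =
    ≡.subst (λ s → SumDegree s (λ x → g x ⊛ h x ⊛ f x)) (≡.sym (ℕ.+-assoc d e d′))
      (sumDegree-resp (λ x → sym (*-assoc (g x) (h x) (f x))) (deg-g (deg-h deg-f)))

  -- Any bound `d` is allowed because `hasDegree-+` wants equal bounds: an affine function needs its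
  -- constant term at bound 1, an empty sum its 0 at the common bound.
  hasDegree-const : ∀ {m} d c → HasDegree {m} d (λ _ → c)
  hasDegree-const {m} d c {d′} {f} deg-f e lt = begin
    ∑^ m (λ x → c ⊛ f x ⊛ monomial e x)     ≈⟨ ∑^-cong m (λ x → *-assoc c (f x) (monomial e x)) ⟩
    ∑^ m (λ x → c ⊛ (f x ⊛ monomial e x))   ≈⟨ ∑^-* m c (λ x → f x ⊛ monomial e x) ⟩
    c ⊛ ∑^ m (λ x → f x ⊛ monomial e x)     ≈⟨ *-congˡ (deg-f e (ℕ.≤-<-trans (ℕ.+-monoˡ-≤ (sumℕ e) (ℕ.m≤n+m d′ d)) lt)) ⟩
    c ⊛ 0#                                  ≈⟨ zeroʳ c ⟩
    0#                                      ∎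

  -- The factor `x i` is absorbed into the test monomial by raising its exponent; hence the
  -- quantification over all monomials in `SumDegree`.
  hasDegree-coordinate : ∀ {m} (i : Fin m) → HasDegree 1 (λ x → x i)
  hasDegree-coordinate {m} i {d} {f} deg-f e lt = begin
    ∑^ m (λ x → x i ⊛ f x ⊛ monomial e x)                    ≈⟨ ∑^-cong m shift ⟩
    ∑^ m (λ x → f x ⊛ monomial (Vector.updateAt e i suc) x)  ≈⟨ deg-f (Vector.updateAt e i suc)
                                                                  (≡.subst (_< m * (q ∸ 1)) 1+d+∣e∣≡ lt) ⟩
    0#                                                       ∎
    where
    shift : ∀ x → x i ⊛ f x ⊛ monomial e x ≈ f x ⊛ monomial (Vector.updateAt e i suc) x
    shift x = begin
      x i ⊛ f x ⊛ monomial e x                     ≈⟨ *-congʳ (*-comm (x i) (f x)) ⟩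
      f x ⊛ x i ⊛ monomial e x                     ≈⟨ *-assoc (f x) (x i) (monomial e x) ⟩
      f x ⊛ (x i ⊛ monomial e x)                   ≈⟨ *-congˡ (monomial-increment e i x) ⟨
      f x ⊛ monomial (Vector.updateAt e i suc) x   ∎
    1+d+∣e∣≡ : suc d + sumℕ e ≡ d + sumℕ (Vector.updateAt e i suc)
    1+d+∣e∣≡ = ≡.sym (≡.trans (≡.cong (d +_) (sumℕ-increment e i)) (ℕ.+-suc d (sumℕ e)))

  hasDegree-sum : ∀ {m d r} (g : Fin r → 𝔽^ m → Carrier) →
                  (∀ i → HasDegree d (g i)) → HasDegree d (λ x → sum (λ i → g i x))
  hasDegree-sum {d = d} {zero}  g deg-g = hasDegree-const d 0#
  hasDegree-sum {d = d} {suc r} g deg-g =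
    hasDegree-+ {d = d} {g zero} {λ x → sum (λ i → g (suc i) x)}
      (deg-g zero) (hasDegree-sum (g ∘ suc) (deg-g ∘ suc))

  hasDegree-product : ∀ {m r} (d : Vector ℕ r) (g : Fin r → 𝔽^ m → Carrier) →
                      (∀ i → HasDegree (d i) (g i)) → HasDegree (sumℕ d) (λ x → product (λ i → g i x))
  hasDegree-product {r = zero}  d g deg-g = hasDegree-const 0 1#
  hasDegree-product {r = suc r} d g deg-g =
    hasDegree-* {d = d zero} {sumℕ (d ∘ suc)} {g zero} {λ x → product (λ i → g (suc i) x)}
      (deg-g zero) (hasDegree-product (d ∘ suc) (g ∘ suc) (deg-g ∘ suc))

  hasDegree-affine : ∀ {m} (β : Vector Carrier m) α → HasDegree 1 (λ x → sum (λ i → x i ⊛ β i) ⊕ α)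
  hasDegree-affine β α =
    hasDegree-+ {d = 1} {λ x → sum (λ i → x i ⊛ β i)} {λ _ → α}
      (hasDegree-sum (λ i x → x i ⊛ β i) λ i →
        hasDegree-* {d = 1} {0} {λ x → x i} {λ _ → β i} (hasDegree-coordinate i) (hasDegree-const 0 (β i)))
      (hasDegree-const 1 α)

  -- Apply the bound on `g` to the constant 1 and test with the monomial of exponent zero.
  ∑^-low-degree : ∀ {m d} {g : 𝔽^ m → Carrier} → HasDegree d g → d < m * (q ∸ 1) → ∑^ m g ≈ 0#
  ∑^-low-degree {m} {d} {g} deg-g d<D = begin
    ∑^ m g                                         ≈⟨ ∑^-cong m (λ x → sym (begin
      g x ⊛ 1# ⊛ monomial (λ _ → 0) x   ≈⟨ *-cong (*-identityʳ (g x)) (monomial-0 m x) ⟩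
      g x ⊛ 1#                          ≈⟨ *-identityʳ (g x) ⟩
      g x                               ∎)) ⟩
    ∑^ m (λ x → g x ⊛ 1# ⊛ monomial (λ _ → 0) x)   ≈⟨ deg-g sumDegree-1 (λ _ → 0)
      (≡.subst (_< m * (q ∸ 1)) (≡.sym d+0+0≡d) d<D) ⟩
    0#                                             ∎
    where
    monomial-0 : ∀ m (x : 𝔽^ m) → monomial (λ _ → 0) x ≈ 1#
    monomial-0 zero    x = refl
    monomial-0 (suc m) x = trans (*-identityˡ _) (monomial-0 m (x ∘ suc))
    d+0+0≡d : d + 0 + sumℕ {m} (λ _ → 0) ≡ d
    d+0+0≡d = ≡.trans (≡.cong (d + 0 +_) (sumℕ-zero m)) (≡.trans (ℕ.+-identityʳ (d + 0)) (ℕ.+-identityʳ d))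

  -- Supports, weights and linear combinations.

  ∈σ⇒≉0 : ∀ {n} (v : 𝔽^ n) {i} → i Subset.∈ σ v → ¬ v i ≈ 0#
  ∈σ⇒≉0 v {i} i∈σv vi≈0 with () ← ≡.trans
    (≡.sym (≡.cong not (dec-true (v i ≟ 0#) vi≈0)))
    (≡.trans (≡.sym (Vec.lookup∘tabulate _ i)) (Vec.[]=⇒lookup i∈σv))

  ≉0⇒∈σ : ∀ {n} (v : 𝔽^ n) {i} → ¬ v i ≈ 0# → i Subset.∈ σ v
  ≉0⇒∈σ v {i} vi≉0 = Vec.lookup⇒[]= i (σ v)
    (≡.trans (Vec.lookup∘tabulate _ i) (≡.cong not (dec-false (v i ≟ 0#) vi≉0)))

  -- Serves both as a summand of the weight and as the degree of the corresponding `factor`.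
  indicator : Carrier → ℕ
  indicator x = if does (x ≟ 0#) then 0 else 1

  indicator-≉0 : ∀ {x} → ¬ x ≈ 0# → indicator x ≡ 1
  indicator-≉0 {x} x≉0 = ≡.cong (if_then 0 else 1) (dec-false (x ≟ 0#) x≉0)

  ω≡∑indicator : ∀ {n} (v : 𝔽^ n) → ω v ≡ sumℕ (indicator ∘ v)
  ω≡∑indicator {zero}  v = ≡.refl
  ω≡∑indicator {suc n} v with does (v zero ≟ 0#)
  ... | true  = ω≡∑indicator (v ∘ suc)
  ... | false = ≡.cong suc (ω≡∑indicator (v ∘ suc))

  ≉0ᵛ⇒∃≉0 : ∀ {n} {v : 𝔽^ n} → ¬ v ≋ 0ᵛ → ∃[ i ] ¬ v i ≈ 0#
  ≉0ᵛ⇒∃≉0 {n} {v} = Fin.¬∀⟶∃¬ n _ (λ i → v i ≟ 0#)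

  combination-∈ : ∀ {n k ℓ} {C : Pred (𝔽^ n) ℓ} → IsSubspace C →
    (s : 𝔽^ k) (b : Vector (𝔽^ n) k) → (∀ i → b i ∈ C) → combination s b ∈ C
  combination-∈ {k = zero}  C-sub s b b∈C = IsSubspace.0-closed C-sub
  combination-∈ {k = suc k} C-sub s b b∈C = IsSubspace.+-closed C-sub
    (IsSubspace.*-closed C-sub (s zero) (b∈C zero))
    (combination-∈ C-sub (s ∘ suc) (b ∘ suc) (b∈C ∘ suc))

  combination-0 : ∀ {n k} (s : 𝔽^ k) (b : Vector (𝔽^ n) k) → s ≋ 0ᵛ → combination s b ≋ 0ᵛ
  combination-0 s b s≈0 j = sum-≈0 _ λ i → trans (*-congʳ (s≈0 i)) (zeroˡ (b i j))

  -- The detecting polynomial of a maximal codeword.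

  factor : Carrier → Carrier → Carrier
  -- The default 1 off the support lets the product run over all coordinates other than i₀.
  factor a y = if does (a ≟ 0#) then 1# else y - a

  factor-cong : ∀ a {y z} → y ≈ z → factor a y ≈ factor a z
  factor-cong a y≈z with does (a ≟ 0#)
  ... | true  = refl
  ... | false = +-congʳ y≈z

  factor-off-0 : ∀ {a} y → ¬ a ≈ 0# → factor a y ≡ y - a
  factor-off-0 {a} y a≉0 = ≡.cong (if_then 1# else (y - a)) (dec-false (a ≟ 0#) a≉0)

  factor-≉0 : ∀ {a y} → (¬ a ≈ 0# → ¬ y ≈ a) → ¬ factor a y ≈ 0#
  factor-≉0 {a} {y} y≉a fy≈0 = y≉a a≉0
    (x∙y⁻¹≈ε⇒x≈y y a (trans (reflexive (≡.sym (factor-off-0 y a≉0))) fy≈0))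
    where
    a≉0 : ¬ a ≈ 0#
    a≉0 a≈0 = 1≉0 (trans
      (reflexive (≡.sym (≡.cong (if_then 1# else (y - a)) (dec-true (a ≟ 0#) a≈0)))) fy≈0)

  factor-≈0 : ∀ {a y} → ¬ a ≈ 0# → y ≈ a → factor a y ≈ 0#
  factor-≈0 {a} {y} a≉0 y≈a =
    trans (reflexive (factor-off-0 y a≉0)) (trans (+-congʳ y≈a) (-‿inverseʳ a))

  hasDegree-factor : ∀ {m} a (β : Vector Carrier m) →
                     HasDegree (indicator a) (λ s → factor a (sum (λ i → s i ⊛ β i)))
  hasDegree-factor a β with does (a ≟ 0#)
  ... | true  = hasDegree-const 0 1#
  ... | false = hasDegree-affine β (- a)

  module _ {n k : ℕ} {ℓ : Level} {C : Pred (𝔽^ n) ℓ} {b : Vector (𝔽^ n) k} {c : 𝔽^ n}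
           (C-sub : IsSubspace C) (basis : IsBasis C b) (c-max : IsMaximalCodeword C c)
           {i₀ : Fin n} (cᵢ₀≉0 : ¬ c i₀ ≈ 0#) where

    open IsMaximalCodeword c-max using (member; maximal)

    nonzero-value : Fin (q ∸ 1) → Carrier
    nonzero-value = from ∘ others (to 0#)

    nonzero-value-≉0 : ∀ j → ¬ nonzero-value j ≈ 0#
    nonzero-value-≉0 j xj≈0 = others-≢ (to 0#) j
      (≡.trans (≡.sym (strictlyInverseˡ _)) (to-cong xj≈0))

    nonzero-value-surjective : ∀ {x} → ¬ x ≈ 0# → ∃[ j ] x ≈ nonzero-value j
    nonzero-value-surjective {x} x≉0 =
      let j , eq = others-surjective {i = to 0#} {to x} λ tx≡t0 → x≉0
                     (trans (sym (strictlyInverseʳ x)) (trans (from-cong tx≡t0) (strictlyInverseʳ 0#)))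
      in j , trans (sym (strictlyInverseʳ x)) (from-cong (≡.sym eq))

    -- Nonzero exactly when v vanishes at i₀ and differs from c on the rest of
    -- the support of c.
    detect-off-i₀ detect-i₀ detect : 𝔽^ n → Carrier
    detect-off-i₀ v = product (λ j → factor (c (others i₀ j)) (v (others i₀ j)))
    detect-i₀     v = product (λ j → v i₀ - nonzero-value j)
    detect        v = detect-off-i₀ v ⊛ detect-i₀ v

    detect-cong : ∀ {u v} → u ≋ v → detect u ≈ detect v
    detect-cong u≈v = *-cong
      (product-cong {n ∸ 1} λ j → factor-cong (c (others i₀ j)) (u≈v (others i₀ j)))
      (product-cong {q ∸ 1} λ j → +-congʳ (u≈v i₀))

    -- At the zero vector every factor is 1 or the negative of a nonzero element.
    detect-0≉0 : ¬ detect 0ᵛ ≈ 0#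
    detect-0≉0 = *-≉0
      (product-≉0 {n ∸ 1} _ λ j → factor-≉0 {c (others i₀ j)} λ a≉0 0≈a → a≉0 (sym 0≈a))
      (product-≉0 {q ∸ 1} _ λ j 0-x≈0 → nonzero-value-≉0 j (sym (x∙y⁻¹≈ε⇒x≈y 0# _ 0-x≈0)))

    detect⇒i₀≈0 : ∀ {v} → ¬ detect v ≈ 0# → v i₀ ≈ 0#
    detect⇒i₀≈0 {v} dv≉0 = decidable-stable (v i₀ ≟ 0#) λ vi₀≉0 →
      let j , vi₀≈xj = nonzero-value-surjective vi₀≉0 in
      dv≉0 (trans (*-congˡ (product-≈0 _ j (trans (+-congʳ vi₀≈xj) (-‿inverseʳ _)))) (zeroʳ _))

    -- Off i₀ this is read from the factors; at i₀ itself v vanishes while c does not.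
    detect⇒≉c : ∀ {v} → ¬ detect v ≈ 0# → ∀ {i} → ¬ c i ≈ 0# → ¬ v i ≈ c i
    detect⇒≉c {v} dv≉0 {i} ci≉0 vi≈ci with i Fin.≟ i₀
    ... | yes ≡.refl = ci≉0 (trans (sym vi≈ci) (detect⇒i₀≈0 {v} dv≉0))
    ... | no  i≢i₀ with j , ≡.refl ← others-surjective i≢i₀ =
      dv≉0 (trans (*-congʳ (product-≈0 _ j (factor-≈0 ci≉0 vi≈ci))) (zeroˡ _))

    -- v − c covers the support of c, hence is a multiple of c; comparing
    -- entries at i₀, the factor is −1.
    detect⇒≈0 : ∀ {v} → v ∈ C → ¬ detect v ≈ 0# → v ≋ 0ᵛ
    detect⇒≈0 {v} v∈C dv≉0 i = +-identityˡ-unique (v i) (- 1# ⊛ c i) (begin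
      v i ⊕ - 1# ⊛ c i   ≈⟨ v-c≈tc i ⟩
      t ⊛ c i            ≈⟨ *-congʳ t≈-1 ⟩
      - 1# ⊛ c i         ∎)
      where
      v-c = v +ᵛ (- 1#) *ᵛ c
      v-c∈C : v-c ∈ C
      v-c∈C = IsSubspace.+-closed C-sub v∈C (IsSubspace.*-closed C-sub (- 1#) member)
      covers : σ c Subset.⊆ σ v-c
      covers {i} i∈σc = ≉0⇒∈σ v-c λ vi-ci≈0 → detect⇒≉c {v} dv≉0 (∈σ⇒≉0 c i∈σc)
        (x∙y⁻¹≈ε⇒x≈y (v i) (c i) (trans (+-congˡ (sym (-1*x≈-x (c i)))) vi-ci≈0))
      t = proj₁ (maximal v-c∈C covers)
      v-c≈tc = proj₂ (maximal v-c∈C covers)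
      t≈-1 : t ≈ - 1#
      t≈-1 = *-cancelˡ-≉0 cᵢ₀≉0 (begin
        c i₀ ⊛ t               ≈⟨ *-comm (c i₀) t ⟩
        t ⊛ c i₀               ≈⟨ v-c≈tc i₀ ⟨
        v i₀ ⊕ - 1# ⊛ c i₀     ≈⟨ +-congʳ (detect⇒i₀≈0 {v} dv≉0) ⟩
        0# ⊕ - 1# ⊛ c i₀       ≈⟨ +-identityˡ _ ⟩
        - 1# ⊛ c i₀            ≈⟨ *-comm (- 1#) (c i₀) ⟩
        c i₀ ⊛ - 1#            ∎)

    -- A nonvanishing term comes from the zero codeword, whose coordinates are zero by independence
    -- of the basis.
    ∑^-detect : ∑^ k (λ s → detect (combination s b)) ≈ detect 0ᵛ
    ∑^-detect = ∑^-supported-at-0 k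
      (λ s s≈0 → detect-cong (combination-0 s b s≈0))
      (λ s s≉0 → decidable-stable (detect (combination s b) ≟ 0#) λ ds≉0 →
        s≉0 (IsBasis.independent basis s
          (detect⇒≈0 (combination-∈ C-sub s b (IsBasis.members basis)) ds≉0)))

    -- This is ω(c) - 1, the number of support positions of c other than i₀.
    excess : ℕ
    excess = sumℕ (indicator ∘ c ∘ others i₀)

    -- Each entry of `combination s b` is a linear form in s, so every nonconstant factor is affine
    -- in s.
    hasDegree-detect : HasDegree {k} (excess + (q ∸ 1)) (λ s → detect (combination s b))
    hasDegree-detect = hasDegree-*
      {d = excess} {q ∸ 1} {λ s → detect-off-i₀ (combination s b)} {λ s → detect-i₀ (combination s b)}
      (hasDegree-product (indicator ∘ c ∘ others i₀)
        (λ j s → factor (c (others i₀ j)) (combination s b (others i₀ j)))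
        λ j → hasDegree-factor (c (others i₀ j)) (λ i → b i (others i₀ j)))
      (≡.subst (λ d → HasDegree d (λ s → detect-i₀ (combination s b))) (sumℕ-replicate-1 (q ∸ 1))
        (hasDegree-product (λ _ → 1) (λ j s → combination s b i₀ - nonzero-value j)
          λ j → hasDegree-affine (λ i → b i i₀) (- nonzero-value j)))

    k[q-1]≤excess+[q-1] : k * (q ∸ 1) ≤ excess + (q ∸ 1)
    k[q-1]≤excess+[q-1] = ℕ.≮⇒≥ λ low → detect-0≉0
      (trans (sym ∑^-detect) (∑^-low-degree hasDegree-detect low))

    ω≡1+excess : ω c ≡ suc excess
    ω≡1+excess = ≡.trans (ω≡∑indicator c)
      (≡.trans (sumℕ-others i₀ (indicator ∘ c)) (≡.cong (_+ excess) (indicator-≉0 cᵢ₀≉0)))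

  -- The weight bound and minimal codes.

  maximal-weight : ∀ {n k ℓ} {C : Pred (𝔽^ n) ℓ} {c : 𝔽^ n} →
    IsSubspace C → HasDimension C k → 1 ≤ k → IsMaximalCodeword C c →
    (q ∸ 1) * (k ∸ 1) + 1 ≤ ω c
  maximal-weight {k = suc k} {c = c} C-sub (b , basis) _ c-max =
    let i₀ , cᵢ₀≉0 = ≉0ᵛ⇒∃≉0 (IsMaximalCodeword.nonzero c-max)
    in suc-bound q-1 k (ω≡1+excess C-sub basis c-max cᵢ₀≉0)
         (k[q-1]≤excess+[q-1] C-sub basis c-max cᵢ₀≉0)
    where
    q-1 = q ∸ 1
    -- With r = q - 1 and dimension k + 1, cancelling one r leaves kr ≤ x; the final + 1 counts the
    -- position i₀.
    suc-bound : ∀ r k {w x} → w ≡ suc x → suc k * r ≤ x + r → r * k + 1 ≤ w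
    suc-bound r k {x = x} ≡.refl r+kr≤x+r = ℕ.≤-trans
      (ℕ.≤-reflexive (≡.trans (ℕ.+-comm (r * k) 1) (≡.cong suc (ℕ.*-comm r k))))
      (s≤s (ℕ.+-cancelˡ-≤ r (k * r) x (ℕ.≤-trans r+kr≤x+r (ℕ.≤-reflexive (ℕ.+-comm x r)))))

  -- If c′ covers the support of c, then c′ is nonzero and its minimality gives c = s c′. As c is
  -- nonzero, s can be inverted.
  minimal⇒maximal : ∀ {n ℓ} {C : Pred (𝔽^ n) ℓ} {c : 𝔽^ n} →
    IsMinimalCode C → c ∈ C → ¬ c ≋ 0ᵛ → IsMaximalCodeword C c
  minimal⇒maximal {C = C} {c} C-min c∈C c≉0 = record
    { member = c∈C ; nonzero = c≉0 ; maximal = maximal }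
    where
    maximal : ∀ {c′} → c′ ∈ C → σ c Subset.⊆ σ c′ → ∃[ s ] c′ ≋ s *ᵛ c
    maximal {c′} c′∈C σc⊆σc′ = s⁻¹ , λ i → begin
      c′ i               ≈⟨ *-identityˡ (c′ i) ⟨
      1# ⊛ c′ i          ≈⟨ *-congʳ s⁻¹s≈1 ⟨
      s⁻¹ ⊛ s ⊛ c′ i     ≈⟨ *-assoc s⁻¹ s (c′ i) ⟩
      s⁻¹ ⊛ (s ⊛ c′ i)   ≈⟨ *-congˡ (c≈sc′ i) ⟨
      s⁻¹ ⊛ c i          ∎
      where
      c′≉0 : ¬ c′ ≋ 0ᵛ
      c′≉0 c′≈0 =
        let i , ci≉0 = ≉0ᵛ⇒∃≉0 c≉0
        in ∈σ⇒≉0 c′ (σc⊆σc′ (≉0⇒∈σ c ci≉0)) (c′≈0 i)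
      c-multiple = IsMinimalCodeword.minimal (C-min c′∈C c′≉0) c∈C σc⊆σc′
      s = proj₁ c-multiple
      c≈sc′ = proj₂ c-multiple
      s≉0 : ¬ s ≈ 0#
      s≉0 s≈0 = c≉0 λ i → trans (c≈sc′ i) (trans (*-congʳ s≈0) (zeroˡ (c′ i)))
      s⁻¹ = proj₁ (inverse s≉0)
      s⁻¹s≈1 = proj₂ (inverse s≉0)

theorem2p8 : ∀ {a ℓ₁ ℓ₂ ℓ : Level} (q : ℕ) → IsPrimePower q →
    (F : FiniteField a ℓ₁ ℓ₂ q) → let open Coding F in
    (n k d : ℕ) → k ≤ n → 1 ≤ k →
    (C : Pred (𝔽^ n) ℓ) → IsCode[ n , k , d ] C →
    (∀ (c : 𝔽^ n) → IsMaximalCodeword C c → ω c ≥ (q ∸ 1) * (k ∸ 1) + 1)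
    × (IsMinimalCode C → d ≥ (q ∸ 1) * (k ∸ 1) + 1)
theorem2p8 q _ F n k d _ 1≤k C C-code =
  (λ c → bound) , λ C-min →
    -- In a minimal code a codeword of minimum weight is maximal, so the first part bounds d.
    let c , c∈C , c≉0 , ωc≡d = attained
    in ≡.subst ((q ∸ 1) * (k ∸ 1) + 1 ≤_) ωc≡d (bound (minimal⇒maximal C-min c∈C c≉0))
  where
  open Field F
  open IsCode[_,_,_] C-code
  open HasMinimumDistance minimumDistance using (attained)
  bound : ∀ {c} → IsMaximalCodeword C c → (q ∸ 1) * (k ∸ 1) + 1 ≤ ω c
  bound = maximal-weight isSubspace dimension 1≤k
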